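{- Let $A$ be an $m\times m$ coloring matrix, let $m'\ge1$, and let $A'$ be the $(m+m')\times(m+m')$ block matrix $$A'=\left[\begin{array}{c|c}A&0\\\hline \mathbf{1}&0\end{array}\right],$$ where $\mathbf{1}$ is the $m'\times m$ all-ones matrix and the $0$ blocks are zero matrices. Then $$F_{A'}(x)=F_A(x)+\frac{m'x}{1-F_A(x)}.$$
   Context: A plane tree is an unlabeled rooted tree in which the children of every vertex are linearly ordered. A coloring matrix is a square matrix $A=(a_{ij})$ with entries in $\{0,1\}$. An $A$-coloring of a plane tree assigns to each vertex a color (an index of a row of $A$) such that whenever a vertex of color $j$ is a child of a vertex of color $i$, $a_{ij}=1$. Let $t_A(n)$ be the number of pairs (plane tree with $n$ vertices, $A$-coloring of it), and $F_A(x)=\sum_{n\ge1}t_A(n)x^n$ (formal power series). -}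

module Defs where

open import Algebra.Properties.Semiring.Sum using (sum⁺-syntax)
open import Data.Empty using (⊥)
open import Data.Fin using (Fin; zero; suc; toℕ; splitAt)
open import Data.Fin.Patterns using (0F; 1F)
import Data.Fin.Properties as Fin
open import Data.Integer as ℤ using (ℤ; +_; 0ℤ; 1ℤ)
import Data.Integer.Properties as ℤ
open import Data.List using (List; []; _∷_)
open import Data.List.Relation.Unary.All using (All; []; _∷_)
open import Data.Nat as ℕ using (ℕ; zero; suc; _≤_; s≤s)
import Data.Nat.Properties as ℕ
open import Data.Product using (Σ; Σ-syntax; _×_; _,_; proj₁; proj₂)
import Data.Product.Function.Dependent.Propositional as Σ
open import Data.Product.Function.NonDependent.Propositional using (_×-↔_)
open import Data.Sum using (_⊎_; inj₁; inj₂; [_,_]′)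
open import Data.Sum.Function.Propositional using (_⊎-↔_)
open import Data.Unit using (⊤; tt)
open import Function.Bundles using (_↔_; mk↔ₛ′; Inverse)
open import Function.Construct.Composition using (_↔-∘_)
open import Function.Construct.Identity using (↔-id)
open import Relation.Binary.PropositionalEquality using (_≡_; refl; cong; module ≡-Reasoning)
open import Relation.Nullary using (yes; no; contradiction)

data PlaneTree : Set where
  node : List PlaneTree → PlaneTree

mutual
  size : PlaneTree → ℕ
  size (node ts) = suc (sizes ts)

  sizes : List PlaneTree → ℕ
  sizes []       = 0
  sizes (t ∷ ts) = size t ℕ.+ sizes ts

Matrix : ℕ → ℕ → Set
Matrix r c = Fin r → Fin c → Fin 2

ColoringMatrix : ℕ → Set
ColoringMatrix m = Matrix m m

-- An assignment of one of m colors to each vertex of a plane tree.  It is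
-- first-order data, rather than a function on vertices, so that _≡_ is the
-- right equality for counting.
data Coloring (m : ℕ) : PlaneTree → Set where
  paint : ∀ {ts} → Fin m → All (Coloring m) ts → Coloring m (node ts)

rootColor : ∀ {m t} → Coloring m t → Fin m
rootColor (paint i _) = i

mutual
  Proper : ∀ {m} → ColoringMatrix m → ∀ {t} → Coloring m t → Set
  Proper A (paint i cs) = ProperBelow A i cs

  -- Every tree of the forest is properly colored, and every root of the
  -- forest has a color allowed for a child of a vertex of color i.
  ProperBelow : ∀ {m} → ColoringMatrix m → Fin m → ∀ {ts} → All (Coloring m) ts → Set
  ProperBelow A i []       = ⊤
  ProperBelow A i (c ∷ cs) = A i (rootColor c) ≡ 1F × Proper A c × ProperBelow A i cs

TreeOfSize : ℕ → Set
TreeOfSize n = Σ[ t ∈ PlaneTree ] size t ≡ n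

AColoring : ∀ {m} → ColoringMatrix m → PlaneTree → Set
AColoring {m} A t = Σ[ c ∈ Coloring m t ] Proper A c

ColoredTree : ∀ {m} → ColoringMatrix m → ℕ → Set
ColoredTree A n = Σ[ T ∈ TreeOfSize n ] AColoring A (proj₁ T)

Finite : Set → Set
Finite X = Σ[ k ∈ ℕ ] (Fin k ↔ X)

finite-↔ : ∀ {X Y} → X ↔ Y → Finite X → Finite Y
finite-↔ f (k , e) = k , f ↔-∘ e

finite-⊥ : Finite ⊥
finite-⊥ = 0 , Fin.0↔⊥

finite-⊤ : Finite ⊤
finite-⊤ = 1 , Fin.1↔⊤

finite-⊎ : ∀ {X Y} → Finite X → Finite Y → Finite (X ⊎ Y)
finite-⊎ (k , e) (l , f) = k ℕ.+ l , (e ⊎-↔ f) ↔-∘ Fin.+↔⊎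

finite-× : ∀ {X Y} → Finite X → Finite Y → Finite (X × Y)
finite-× (k , e) (l , f) = k ℕ.* l , (e ×-↔ f) ↔-∘ Fin.*↔×

finite-ΣFin : ∀ k {Y : Fin k → Set} → (∀ i → Finite (Y i)) → Finite (Σ (Fin k) Y)
finite-ΣFin zero    fin = finite-↔ (mk↔ₛ′ (λ ()) (λ ()) (λ ()) (λ ())) finite-⊥
finite-ΣFin (suc k) fin = finite-↔
  (mk↔ₛ′ (λ { (inj₁ y) → zero , y ; (inj₂ (i , y)) → suc i , y })
         (λ { (zero , y) → inj₁ y ; (suc i , y) → inj₂ (i , y) })
         (λ { (zero , y) → refl ; (suc i , y) → refl })
         (λ { (inj₁ y) → refl ; (inj₂ (i , y)) → refl }))
  (finite-⊎ (fin zero) (finite-ΣFin k (λ i → fin (suc i))))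

finite-Σ : ∀ {X} {Y : X → Set} → Finite X → (∀ x → Finite (Y x)) → Finite (Σ X Y)
finite-Σ (k , e) fin =
  finite-↔ (Σ.Σ-↔ e (↔-id _)) (finite-ΣFin k (λ i → fin (Inverse.to e i)))

finite-≡ : ∀ {k} (i j : Fin k) → Finite (i ≡ j)
finite-≡ i j with i Fin.≟ j
... | yes refl = finite-↔ (mk↔ₛ′ (λ _ → refl) (λ _ → tt) (λ { refl → refl }) (λ _ → refl)) finite-⊤
... | no  i≢j  = finite-↔ (mk↔ₛ′ (λ ()) i≢j (λ p → contradiction p i≢j) (λ ())) finite-⊥

Split : ℕ → Set
Split n = Σ[ k ∈ ℕ ] Σ[ l ∈ ℕ ] k ℕ.+ l ≡ n

finite-Split : ∀ n → Finite (Split n)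
finite-Split zero = finite-↔
  (mk↔ₛ′ (λ _ → 0 , 0 , refl) (λ _ → tt) (λ { (zero , zero , refl) → refl }) (λ _ → refl))
  finite-⊤
finite-Split (suc n) = finite-↔
  (mk↔ₛ′ (λ { (inj₁ _) → 0 , suc n , refl ; (inj₂ (k , l , refl)) → suc k , l , refl })
         (λ { (zero , _ , _) → inj₁ tt ; (suc k , l , refl) → inj₂ (k , l , refl) })
         (λ { (zero , _ , refl) → refl ; (suc k , l , refl) → refl })
         (λ { (inj₁ _) → refl ; (inj₂ (k , l , refl)) → refl }))
  (finite-⊎ finite-⊤ (finite-Split n))

ForestOfSize : ℕ → Set
ForestOfSize n = Σ[ ts ∈ List PlaneTree ] sizes ts ≡ n

-- A nonempty forest is the list of subtrees below the root of its first
-- tree, together with its remaining trees.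
forest-split : ∀ n → (Σ[ s ∈ Split n ] ForestOfSize (proj₁ s) × ForestOfSize (proj₁ (proj₂ s)))
                     ↔ ForestOfSize (suc n)
forest-split n = mk↔ₛ′
  (λ { ((k , l , refl) , (ts , refl) , (us , refl)) → node ts ∷ us , refl })
  (λ { (node ts ∷ us , refl) → (sizes ts , sizes us , refl) , (ts , refl) , (us , refl) })
  (λ { (node ts ∷ us , refl) → refl })
  (λ { ((k , l , refl) , (ts , refl) , (us , refl)) → refl })

finite-Forest : ∀ b n → n ≤ b → Finite (ForestOfSize n)
finite-Forest b zero _ = finite-↔
  (mk↔ₛ′ (λ _ → [] , refl) (λ _ → tt) (λ { ([] , refl) → refl ; (node _ ∷ _ , ()) }) (λ _ → refl))
  finite-⊤
finite-Forest (suc b) (suc n) (s≤s n≤b) = finite-↔ (forest-split n)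
  (finite-Σ (finite-Split n) λ { (k , l , refl) →
    finite-× (finite-Forest b k (ℕ.≤-trans (ℕ.m≤m+n k l) n≤b))
             (finite-Forest b l (ℕ.≤-trans (ℕ.m≤n+m l k) n≤b)) })

finite-TreeOfSize : ∀ n → Finite (TreeOfSize n)
finite-TreeOfSize zero    = finite-↔ (mk↔ₛ′ (λ ()) (λ { (node _ , ()) }) (λ { (node _ , ()) }) (λ ())) finite-⊥
finite-TreeOfSize (suc n) = finite-↔
  (mk↔ₛ′ (λ { (ts , refl) → node ts , refl }) (λ { (node ts , refl) → ts , refl })
         (λ { (node ts , refl) → refl }) (λ { (ts , refl) → refl }))
  (finite-Forest n n ℕ.≤-refl)

mutual
  finite-Coloring : ∀ m t → Finite (Coloring m t)
  finite-Coloring m (node ts) = finite-↔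
    (mk↔ₛ′ (λ { (i , cs) → paint i cs }) (λ { (paint i cs) → i , cs })
           (λ { (paint i cs) → refl }) (λ { (i , cs) → refl }))
    (finite-× (m , ↔-id _) (finite-Colorings m ts))

  finite-Colorings : ∀ m ts → Finite (All (Coloring m) ts)
  finite-Colorings m []       = finite-↔
    (mk↔ₛ′ (λ _ → []) (λ _ → tt) (λ { [] → refl }) (λ _ → refl)) finite-⊤
  finite-Colorings m (t ∷ ts) = finite-↔
    (mk↔ₛ′ (λ { (c , cs) → c ∷ cs }) (λ { (c ∷ cs) → c , cs })
           (λ { (c ∷ cs) → refl }) (λ { (c , cs) → refl }))
    (finite-× (finite-Coloring m t) (finite-Colorings m ts))

mutual
  finite-Proper : ∀ {m} (A : ColoringMatrix m) {t} (c : Coloring m t) → Finite (Proper A c)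
  finite-Proper A (paint i cs) = finite-ProperBelow A i cs

  finite-ProperBelow : ∀ {m} (A : ColoringMatrix m) i {ts} (cs : All (Coloring m) ts) →
                       Finite (ProperBelow A i cs)
  finite-ProperBelow A i []       = finite-⊤
  finite-ProperBelow A i (c ∷ cs) =
    finite-× (finite-≡ _ _) (finite-× (finite-Proper A c) (finite-ProperBelow A i cs))

finite-ColoredTree : ∀ {m} (A : ColoringMatrix m) n → Finite (ColoredTree A n)
finite-ColoredTree A n = finite-Σ (finite-TreeOfSize n) λ T →
  finite-Σ (finite-Coloring _ (proj₁ T)) (finite-Proper A)

t : ∀ {m} → ColoringMatrix m → ℕ → ℕ
t A n = proj₁ (finite-ColoredTree A n)

t-counts : ∀ {m} (A : ColoringMatrix m) n → Fin (t A n) ↔ ColoredTree A n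
t-counts A n = proj₂ (finite-ColoredTree A n)

Series : Set
Series = ℕ → ℤ

infix  4 _≈_
infixl 6 _⊕_ _⊖_
infixl 7 _⊛_ _÷_[_]

_≈_ : Series → Series → Set
P ≈ Q = ∀ n → P n ≡ Q n

const : ℤ → Series
const a zero    = a
const a (suc n) = 0ℤ

X : Series
X 1 = 1ℤ
X _ = 0ℤ

_⊕_ _⊖_ _⊛_ : Series → Series → Series
(P ⊕ Q) n = P n ℤ.+ Q n
(P ⊖ Q) n = P n ℤ.- Q n
(P ⊛ Q) n = sum⁺-syntax ℤ.+-*-semiring n (λ k → P (toℕ k) ℤ.* Q (n ℕ.∸ toℕ k))

-- Long division by a series with constant term 1: writing
-- P = P₀ Q + x R, one has P / Q = P₀ + x (R / Q).
_÷_[_] : Series → (Q : Series) → Q 0 ≡ 1ℤ → Series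
(P ÷ Q [ Q₀≡1 ]) zero    = P 0
(P ÷ Q [ Q₀≡1 ]) (suc n) = ((λ k → P (suc k) ℤ.- P 0 ℤ.* Q (suc k)) ÷ Q [ Q₀≡1 ]) n

÷-⊛ : ∀ P Q (Q₀≡1 : Q 0 ≡ 1ℤ) → (P ÷ Q [ Q₀≡1 ]) ⊛ Q ≈ P
÷-⊛ P Q Q₀≡1 zero = begin
  P 0 ℤ.* Q 0 ℤ.+ 0ℤ  ≡⟨ ℤ.+-identityʳ _ ⟩
  P 0 ℤ.* Q 0         ≡⟨ cong (P 0 ℤ.*_) Q₀≡1 ⟩
  P 0 ℤ.* 1ℤ          ≡⟨ ℤ.*-identityʳ _ ⟩
  P 0                 ∎
  where open ≡-Reasoning
÷-⊛ P Q Q₀≡1 (suc n) = begin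
  a ℤ.+ ((R ÷ Q [ Q₀≡1 ]) ⊛ Q) n  ≡⟨ cong (λ r → a ℤ.+ r) (÷-⊛ R Q Q₀≡1 n) ⟩
  a ℤ.+ (P (suc n) ℤ.- a)         ≡⟨ ℤ.+-comm a _ ⟩
  P (suc n) ℤ.- a ℤ.+ a           ≡⟨ ℤ.+-assoc (P (suc n)) (ℤ.- a) a ⟩
  P (suc n) ℤ.+ (ℤ.- a ℤ.+ a)     ≡⟨ cong (λ r → P (suc n) ℤ.+ r) (ℤ.+-inverseˡ a) ⟩
  P (suc n) ℤ.+ 0ℤ                ≡⟨ ℤ.+-identityʳ _ ⟩
  P (suc n)                       ∎
  where
  open ≡-Reasoning
  a = P 0 ℤ.* Q (suc n)
  R : Series
  R k = P (suc k) ℤ.- P 0 ℤ.* Q (suc k)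

F : ∀ {m} → ColoringMatrix m → Series
F A zero    = 0ℤ
F A (suc n) = + t A (suc n)

zeros ones : ∀ {r c} → Matrix r c
zeros _ _ = 0F
ones  _ _ = 1F

block : ∀ {r r′ c c′} → Matrix r c → Matrix r c′ → Matrix r′ c → Matrix r′ c′ →
        Matrix (r ℕ.+ r′) (c ℕ.+ c′)
block {r} {c = c} P Q R S i j =
  [ (λ i₁ → [ P i₁ , Q i₁ ]′ (splitAt c j))
  , (λ i₂ → [ R i₂ , S i₂ ]′ (splitAt c j)) ]′ (splitAt r i)

{-# OPTIONS --safe #-}

-- In an A′-colored tree a vertex of one of the m′ new colors is nobody's child,
-- so new colors occur at most at the root.  An A′-colored tree is therefore
-- either an A-colored tree, or a root of one of m′ colors above an arbitrary
-- ordered forest of A-colored trees.  Splitting off the first tree of such a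
-- forest shows that the series G of forests satisfies G = 1 + F_A G, that is
-- G = 1 / (1 - F_A).
module Submission where

import Algebra.Properties.Semiring.Sum
open import Data.Fin using (Fin; toℕ; opposite; _↑ˡ_; _↑ʳ_)
open import Data.Fin.Patterns using (0F; 1F)
open import Data.Fin.Permutation using (reverse; ↔⇒≡)
import Data.Fin.Properties as Fin
open import Data.Integer as ℤ using (+_; 0ℤ; 1ℤ; -1ℤ)
import Data.Integer.Properties as ℤ
open import Data.List using (List; []; _∷_)
open import Data.List.Relation.Unary.All using (All; []; _∷_)
open import Data.Nat using (ℕ; zero; suc; _+_; _∸_; _≥_)
import Data.Nat.Properties as ℕ
open import Data.Product using (Σ; Σ-syntax; _×_; _,_; proj₁; proj₂)
import Data.Product.Function.Dependent.Propositional as Σ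
open import Data.Product.Function.NonDependent.Propositional using (_×-↔_)
open import Data.Sum using (_⊎_; inj₁; inj₂)
open import Data.Sum.Function.Propositional using (_⊎-↔_)
open import Data.Unit using (⊤; tt)
open import Function.Base using (_∘_)
open import Function.Bundles using (_↔_; mk↔ₛ′)
open import Function.Properties.Inverse using (↔-refl; ↔-sym; ↔-trans)
open import Function.Related.Propositional using (≡⇒; bijection; module EquationalReasoning)
open import Function.Related.TypeIsomorphisms using (Σ-distribˡ-⊎; Σ-distribʳ-⊎; ∃∃↔∃∃)
open import Relation.Binary.PropositionalEquality using (_≡_; refl; sym; trans; cong; cong₂; module ≡-Reasoning)
open import Defs

private
  module Sum = Algebra.Properties.Semiring.Sum ℤ.+-*-semiring

-- Power series

⊛-comm : ∀ P Q → P ⊛ Q ≈ Q ⊛ P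
⊛-comm P Q n = begin
  Sum.sum {suc n} (λ k → P (toℕ k) ℤ.* Q (n ∸ toℕ k))
    ≡⟨ Sum.sum-permute (λ k → P (toℕ k) ℤ.* Q (n ∸ toℕ k)) reverse ⟩
  Sum.sum {suc n} (λ k → P (toℕ (opposite k)) ℤ.* Q (n ∸ toℕ (opposite k)))
    ≡⟨ Sum.sum-cong-≗ swap ⟩
  Sum.sum {suc n} (λ k → Q (toℕ k) ℤ.* P (n ∸ toℕ k)) ∎
  where
  open ≡-Reasoning
  swap : ∀ (k : Fin (suc n)) →
         P (toℕ (opposite k)) ℤ.* Q (n ∸ toℕ (opposite k)) ≡ Q (toℕ k) ℤ.* P (n ∸ toℕ k)
  swap k rewrite Fin.opposite-prop k | ℕ.m∸[m∸n]≡n (Fin.toℕ≤pred[n] k) = ℤ.*-comm (P (n ∸ toℕ k)) _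

⊛-cong : ∀ {P P′ Q Q′} → P ≈ P′ → Q ≈ Q′ → P ⊛ Q ≈ P′ ⊛ Q′
⊛-cong P≈ Q≈ n = Sum.sum-cong-≗ {suc n} λ k → cong₂ ℤ._*_ (P≈ (toℕ k)) (Q≈ (n ∸ toℕ k))

⊛-scaleˡ : ∀ a P Q n → ((λ k → a ℤ.* P k) ⊛ Q) n ≡ a ℤ.* (P ⊛ Q) n
⊛-scaleˡ a P Q n = begin
  Sum.sum {suc n} (λ k → a ℤ.* P (toℕ k) ℤ.* Q (n ∸ toℕ k))
    ≡⟨ Sum.sum-cong-≗ {suc n} (λ k → ℤ.*-assoc a (P (toℕ k)) (Q (n ∸ toℕ k))) ⟩
  Sum.sum {suc n} (λ k → a ℤ.* (P (toℕ k) ℤ.* Q (n ∸ toℕ k)))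
    ≡⟨ Sum.*-distribˡ-sum a (λ (k : Fin (suc n)) → P (toℕ k) ℤ.* Q (n ∸ toℕ k)) ⟨
  a ℤ.* (P ⊛ Q) n ∎
  where open ≡-Reasoning

const-⊛ : ∀ a Q n → (const a ⊛ Q) n ≡ a ℤ.* Q n
const-⊛ a Q zero    = ℤ.+-identityʳ _
const-⊛ a Q (suc n) = begin
  -- The tail of `const a` is zero, hence `0ℤ` times itself; pulled out of the product, the factor
  -- `0ℤ` annihilates it.
  a ℤ.* Q (suc n) ℤ.+ ((λ _ → 0ℤ) ⊛ Q) n  ≡⟨ cong (λ r → a ℤ.* Q (suc n) ℤ.+ r) (⊛-scaleˡ 0ℤ (λ _ → 0ℤ) Q n) ⟩
  a ℤ.* Q (suc n) ℤ.+ 0ℤ                  ≡⟨ ℤ.+-identityʳ _ ⟩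
  a ℤ.* Q (suc n)                         ∎
  where open ≡-Reasoning

-- Comparing constant terms forces `H 0` to be `P 0`, the first coefficient of the long division.
-- Then `H ∘ suc` times `Q` is the remainder, so the claim recurs on the tail.
÷-unique : ∀ P Q (Q₀≡1 : Q 0 ≡ 1ℤ) H → H ⊛ Q ≈ P → P ÷ Q [ Q₀≡1 ] ≈ H
÷-unique P Q Q₀≡1 H HQ≈P zero = begin
  P 0                 ≡⟨ HQ≈P 0 ⟨
  H 0 ℤ.* Q 0 ℤ.+ 0ℤ  ≡⟨ ℤ.+-identityʳ _ ⟩
  H 0 ℤ.* Q 0         ≡⟨ cong (H 0 ℤ.*_) Q₀≡1 ⟩
  H 0 ℤ.* 1ℤ          ≡⟨ ℤ.*-identityʳ _ ⟩
  H 0                 ∎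
  where open ≡-Reasoning
÷-unique P Q Q₀≡1 H HQ≈P (suc n) = ÷-unique _ Q Q₀≡1 (H ∘ suc) tail-eq n
  where
  open ≡-Reasoning
  tail-eq : (H ∘ suc) ⊛ Q ≈ (λ k → P (suc k) ℤ.- P 0 ℤ.* Q (suc k))
  tail-eq k = begin
    r                                ≡⟨ ℤ.+-identityʳ r ⟨
    r ℤ.+ 0ℤ                         ≡⟨ cong (λ z → r ℤ.+ z) (ℤ.+-inverseʳ a) ⟨
    r ℤ.+ (a ℤ.- a)                  ≡⟨ ℤ.+-assoc r a (ℤ.- a) ⟨
    r ℤ.+ a ℤ.- a                    ≡⟨ cong (ℤ._- a) (ℤ.+-comm r a) ⟩
    -- By unfolding, `a ℤ.+ r` is coefficient `suc k` of `H ⊛ Q`; the case `zero` identifies `H 0`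
    -- with `P 0`.
    a ℤ.+ r ℤ.- a                    ≡⟨ cong₂ (λ p h → p ℤ.- h ℤ.* Q (suc k)) (HQ≈P (suc k)) (sym (÷-unique P Q Q₀≡1 H HQ≈P zero)) ⟩
    P (suc k) ℤ.- P 0 ℤ.* Q (suc k)  ∎
    where
    a = H 0 ℤ.* Q (suc k)
    r = ((H ∘ suc) ⊛ Q) k

-- Multiplication by x.
shift : Series → Series
shift P zero    = 0ℤ
shift P (suc n) = P n

-- The recurrence is coefficient n + 1 of G = 1 + P G, where `P 0 ≡ 0ℤ` has removed the summand
-- containing `G (suc n)`.
geometric : ∀ P → P 0 ≡ 0ℤ → ∀ G → G 0 ≡ 1ℤ → (∀ n → G (suc n) ≡ ((P ∘ suc) ⊛ G) n) →
            (const 1ℤ ⊖ P) ⊛ G ≈ const 1ℤ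
geometric P P₀≡0 G G₀≡1 rec zero rewrite P₀≡0 | G₀≡1 = refl
geometric P P₀≡0 G G₀≡1 rec (suc n) rewrite P₀≡0 = begin
  1ℤ ℤ.* G (suc n) ℤ.+ ((λ k → 0ℤ ℤ.- P (suc k)) ⊛ G) n
    -- `neg` turns negation into scaling by `-1ℤ`, which `⊛-scaleˡ` can pull out.
    ≡⟨ cong₂ ℤ._+_ (trans (ℤ.*-identityˡ _) (rec n)) (⊛-cong {Q = G} neg (λ _ → refl) n) ⟩
  r ℤ.+ ((λ k → -1ℤ ℤ.* P (suc k)) ⊛ G) n
    ≡⟨ cong (λ z → r ℤ.+ z) (trans (⊛-scaleˡ -1ℤ (P ∘ suc) G n) (ℤ.-1*i≡-i r)) ⟩
  r ℤ.- r
    ≡⟨ ℤ.+-inverseʳ r ⟩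
  0ℤ ∎
  where
  open ≡-Reasoning
  r = ((P ∘ suc) ⊛ G) n
  neg : (λ k → 0ℤ ℤ.- P (suc k)) ≈ (λ k → -1ℤ ℤ.* P (suc k))
  neg k = trans (ℤ.+-identityˡ _) (sym (ℤ.-1*i≡-i (P (suc k))))

-- The candidate a x G is checked by multiplying back by `Q`; `÷-unique` then identifies it with the
-- quotient.
monomial-÷ : ∀ a Q (Q₀≡1 : Q 0 ≡ 1ℤ) G → Q ⊛ G ≈ const 1ℤ →
             (const a ⊛ X) ÷ Q [ Q₀≡1 ] ≈ shift (λ n → a ℤ.* G n)
monomial-÷ a Q Q₀≡1 G QG≈1 = ÷-unique _ Q Q₀≡1 _ product
  where
  open ≡-Reasoning
  one≡X : ∀ n → const 1ℤ n ≡ X (suc n)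
  one≡X zero    = refl
  one≡X (suc n) = refl
  product : shift (λ n → a ℤ.* G n) ⊛ Q ≈ const a ⊛ X
  product zero    = sym (trans (const-⊛ a X 0) (ℤ.*-zeroʳ a))
  product (suc n) = begin
    0ℤ ℤ.+ ((λ k → a ℤ.* G k) ⊛ Q) n  ≡⟨ ℤ.+-identityˡ _ ⟩
    ((λ k → a ℤ.* G k) ⊛ Q) n         ≡⟨ ⊛-scaleˡ a G Q n ⟩
    a ℤ.* (G ⊛ Q) n                   ≡⟨ cong (a ℤ.*_) (trans (⊛-comm G Q n) (QG≈1 n)) ⟩
    a ℤ.* const 1ℤ n                  ≡⟨ cong (a ℤ.*_) (one≡X n) ⟩
    a ℤ.* X (suc n)                   ≡⟨ const-⊛ a X (suc n) ⟨
    (const a ⊛ X) (suc n)             ∎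

-- Counting

∣_∣ : ∀ {S} → Finite S → ℕ
∣ fin ∣ = proj₁ fin

-- Counts such as `t` are read off one particular enumeration; this makes them comparable along any
-- bijection.
↔⇒∣∣≡ : ∀ {S T} (finS : Finite S) (finT : Finite T) → S ↔ T → ∣ finS ∣ ≡ ∣ finT ∣
↔⇒∣∣≡ (k , e) (l , f) S↔T = ↔⇒≡ (↔-trans e (↔-trans S↔T (↔-sym f)))

Convolution : (ℕ → Set) → (ℕ → Set) → ℕ → Set
Convolution S T n = Σ[ s ∈ Split n ] S (proj₁ s) × T (proj₁ (proj₂ s))

convolution-zero : ∀ S T → (S 0 × T 0) ↔ Convolution S T 0
convolution-zero S T = mk↔ₛ′
  (λ p → (0 , 0 , refl) , p) (λ { ((zero , zero , refl) , p) → p })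
  (λ { ((zero , zero , refl) , p) → refl }) (λ _ → refl)

-- Separates the splits whose first part is 0, just as the sum in `⊛` sheds its first summand and
-- leaves a product with a shifted left factor.
convolution-suc : ∀ S T n → (S 0 × T (suc n) ⊎ Convolution (S ∘ suc) T n) ↔ Convolution S T (suc n)
convolution-suc S T n = mk↔ₛ′
  (λ { (inj₁ p) → (0 , suc n , refl) , p ; (inj₂ ((k , l , refl) , p)) → (suc k , l , refl) , p })
  (λ { ((zero , _ , refl) , p) → inj₁ p ; ((suc k , l , refl) , p) → inj₂ ((k , l , refl) , p) })
  (λ { ((zero , _ , refl) , p) → refl ; ((suc k , l , refl) , p) → refl })
  (λ { (inj₁ p) → refl ; (inj₂ ((k , l , refl) , p)) → refl })

module _ {T : ℕ → Set} (finT : ∀ n → Finite (T n)) where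

  -- The recursion follows the unfolding of `⊛`, so that the count in `∣Convolution∣` computes
  -- summand by summand.
  finite-Convolution : ∀ {S : ℕ → Set} → (∀ n → Finite (S n)) → ∀ n → Finite (Convolution S T n)
  finite-Convolution {S} finS zero    = finite-↔ (convolution-zero S T) (finite-× (finS 0) (finT 0))
  finite-Convolution {S} finS (suc n) = finite-↔ (convolution-suc S T n)
    (finite-⊎ (finite-× (finS 0) (finT (suc n))) (finite-Convolution (finS ∘ suc) n))

  ∣Convolution∣ : ∀ {S : ℕ → Set} (finS : ∀ n → Finite (S n)) n →
    + ∣ finite-Convolution finS n ∣ ≡ ((λ k → + ∣ finS k ∣) ⊛ (λ l → + ∣ finT l ∣)) n
  ∣Convolution∣ finS zero    = trans (ℤ.pos-* ∣ finS 0 ∣ _) (sym (ℤ.+-identityʳ _))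
  ∣Convolution∣ finS (suc n) =
    cong₂ ℤ._+_ (ℤ.pos-* ∣ finS 0 ∣ _) (∣Convolution∣ (finS ∘ suc) n)

-- Colored trees and forests

all-[] : ∀ {T : Set} {P : T → Set} → ⊤ ↔ All P []
all-[] = mk↔ₛ′ (λ _ → []) _ (λ { [] → refl }) (λ _ → refl)

all-∷ : ∀ {T : Set} {P : T → Set} {x xs} → (P x × All P xs) ↔ All P (x ∷ xs)
all-∷ = mk↔ₛ′ (λ (p , ps) → p ∷ ps) (λ { (p ∷ ps) → p , ps })
  (λ { (p ∷ ps) → refl }) (λ { (p , ps) → refl })

Below : ∀ {m} → ColoringMatrix m → Fin m → List PlaneTree → Set
Below {m} A i ts = Σ[ cs ∈ All (Coloring m) ts ] ProperBelow A i cs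

module _ {m} (A : ColoringMatrix m) where

  below-[] : ∀ {i} → Below A i [] ↔ ⊤
  below-[] = mk↔ₛ′ _ (λ _ → [] , tt) (λ _ → refl) (λ { ([] , tt) → refl })

  -- Exposes the root color `j` of the first tree as a summation index, so that row `i` of the
  -- matrix can be split into blocks.
  below-∷ : ∀ {i us ts} → Below A i (node us ∷ ts) ↔
            ((Σ[ j ∈ Fin m ] A i j ≡ 1F × Below A j us) × Below A i ts)
  below-∷ = mk↔ₛ′
    (λ { (paint j ds ∷ cs , a , p , q) → (j , a , ds , p) , cs , q })
    (λ { ((j , a , ds , p) , cs , q) → paint j ds ∷ cs , a , p , q })
    (λ _ → refl)
    (λ { (paint j ds ∷ cs , a , p , q) → refl })

  coloring-node : ∀ {ts} → AColoring A (node ts) ↔ (Σ[ i ∈ Fin m ] Below A i ts)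
  coloring-node = mk↔ₛ′
    (λ { (paint i cs , p) → i , cs , p }) (λ { (i , cs , p) → paint i cs , p })
    (λ _ → refl) (λ { (paint i cs , p) → refl })

  ColoredForest : ℕ → Set
  ColoredForest n = Σ[ f ∈ ForestOfSize n ] All (AColoring A) (proj₁ f)

  finite-AColorings : ∀ ts → Finite (All (AColoring A) ts)
  finite-AColorings []       = finite-↔ all-[] finite-⊤
  finite-AColorings (t ∷ ts) = finite-↔ all-∷
    (finite-× (finite-Σ (finite-Coloring m t) (finite-Proper A)) (finite-AColorings ts))

  finite-ColoredForest : ∀ n → Finite (ColoredForest n)
  finite-ColoredForest n =
    finite-Σ (finite-Forest n n ℕ.≤-refl) (finite-AColorings ∘ proj₁)

  forest-zero : ColoredForest 0 ↔ ⊤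
  forest-zero = mk↔ₛ′ _ (λ _ → ([] , refl) , []) (λ _ → refl)
    (λ { (([] , refl) , []) → refl ; ((node _ ∷ _ , ()) , _) })

  -- The first tree has a root, so its size is `suc k`; hence `k` and the size of the remaining
  -- forest add up to `n`.
  forest-suc : ∀ n → ColoredForest (suc n) ↔ Convolution (ColoredTree A ∘ suc) ColoredForest n
  forest-suc n = mk↔ₛ′
    (λ { ((node ts ∷ us , refl) , c ∷ cs) →
         (sizes ts , sizes us , refl) , ((node ts , refl) , c) , (us , refl) , cs })
    (λ { ((k , l , refl) , ((node ts , refl) , c) , (us , refl) , cs) →
         (node ts ∷ us , refl) , c ∷ cs })
    (λ { ((k , l , refl) , ((node ts , refl) , c) , (us , refl) , cs) → refl })
    (λ { ((node ts ∷ us , refl) , c ∷ cs) → refl })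

  -- The series 1 / (1 - F_A).
  forestSeries : Series
  forestSeries n = + ∣ finite-ColoredForest n ∣

  forestSeries-zero : forestSeries 0 ≡ 1ℤ
  forestSeries-zero = cong +_ (↔⇒∣∣≡ (finite-ColoredForest 0) finite-⊤ forest-zero)

  forestSeries-suc : ∀ n → forestSeries (suc n) ≡ ((F A ∘ suc) ⊛ forestSeries) n
  forestSeries-suc n = trans
    (cong +_ (↔⇒∣∣≡ (finite-ColoredForest (suc n))
                    (finite-Convolution finite-ColoredForest (finite-ColoredTree A ∘ suc) n)
                    (forest-suc n)))
    (∣Convolution∣ finite-ColoredForest (finite-ColoredTree A ∘ suc) n)

  tree-suc : ∀ n → ColoredTree A (suc n) ↔
             (Σ[ f ∈ ForestOfSize n ] Σ[ i ∈ Fin m ] Below A i (proj₁ f))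
  tree-suc n = ↔-trans
    (mk↔ₛ′ (λ { ((node ts , refl) , c) → (ts , refl) , c })
           (λ { ((ts , refl) , c) → (node ts , refl) , c })
           (λ { ((ts , refl) , c) → refl })
           (λ { ((node ts , refl) , c) → refl }))
    (Σ.congˡ {k = bijection} coloring-node)

-- The block matrix

Σ-Fin-+ : ∀ m {n} (P : Fin (m + n) → Set) →
          Σ (Fin (m + n)) P ↔ (Σ (Fin m) (λ i → P (i ↑ˡ n)) ⊎ Σ (Fin n) (λ i → P (m ↑ʳ i)))
Σ-Fin-+ m P = ↔-trans
  (↔-sym (Σ.cong {k = bijection} (↔-sym (Fin.+↔⊎ {m})) ↔-refl)) Σ-distribʳ-⊎

-- A zero entry forbids the color for a child, so the last `n` colors contribute nothing. It serves
-- both kinds of rows of the block matrix, with `s` a row of `A` or all ones.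
Σ-row : ∀ {m n} (r : Fin (m + n) → Fin 2) (s : Fin m → Fin 2) →
        (∀ j → r (j ↑ˡ n) ≡ s j) → (∀ j → r (m ↑ʳ j) ≡ 0F) → (P : Fin (m + n) → Set) →
        (Σ[ j ∈ Fin (m + n) ] r j ≡ 1F × P j) ↔ (Σ[ j ∈ Fin m ] s j ≡ 1F × P (j ↑ˡ n))
Σ-row {m} {n} r s left right P = begin
  (Σ[ j ∈ Fin (m + n) ] r j ≡ 1F × P j)
    ↔⟨ Σ-Fin-+ m _ ⟩
  ((Σ[ j ∈ Fin m ] r (j ↑ˡ n) ≡ 1F × P (j ↑ˡ n)) ⊎ (Σ[ j ∈ Fin n ] r (m ↑ʳ j) ≡ 1F × P (m ↑ʳ j)))
    ↔⟨ mk↔ₛ′ (λ { (inj₁ x) → x ; (inj₂ (j , e , _)) → absurd j e }) inj₁ (λ _ → refl)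
             (λ { (inj₁ x) → refl ; (inj₂ (j , e , _)) → absurd j e }) ⟩
  (Σ[ j ∈ Fin m ] r (j ↑ˡ n) ≡ 1F × P (j ↑ˡ n))
    ↔⟨ Σ.congˡ {k = bijection} (λ {j} → ≡⇒ (cong (_≡ 1F) (left j)) ×-↔ ↔-refl) ⟩
  (Σ[ j ∈ Fin m ] s j ≡ 1F × P (j ↑ˡ n)) ∎
  where
  open EquationalReasoning
  absurd : ∀ {W : Set} j → r (m ↑ʳ j) ≡ 1F → W
  absurd j e with trans (sym (right j)) e
  ... | ()

module _ {m} (A : ColoringMatrix m) (m′ : ℕ) where
  open EquationalReasoning

  private
    A′ : ColoringMatrix (m + m′)
    A′ = block A zeros ones zeros

  A′-↑ˡ-↑ˡ : ∀ i j → A′ (i ↑ˡ m′) (j ↑ˡ m′) ≡ A i j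
  A′-↑ˡ-↑ˡ i j rewrite Fin.splitAt-↑ˡ m i m′ | Fin.splitAt-↑ˡ m j m′ = refl

  A′-↑ˡ-↑ʳ : ∀ i j → A′ (i ↑ˡ m′) (m ↑ʳ j) ≡ 0F
  A′-↑ˡ-↑ʳ i j rewrite Fin.splitAt-↑ˡ m i m′ | Fin.splitAt-↑ʳ m m′ j = refl

  A′-↑ʳ-↑ˡ : ∀ i j → A′ (m ↑ʳ i) (j ↑ˡ m′) ≡ 1F
  A′-↑ʳ-↑ˡ i j rewrite Fin.splitAt-↑ʳ m m′ i | Fin.splitAt-↑ˡ m j m′ = refl

  A′-↑ʳ-↑ʳ : ∀ i j → A′ (m ↑ʳ i) (m ↑ʳ j) ≡ 0F
  A′-↑ʳ-↑ʳ i j rewrite Fin.splitAt-↑ʳ m m′ i | Fin.splitAt-↑ʳ m m′ j = refl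

  -- The upper right zero block keeps new colors out of the children of an old color; recursion into
  -- `us` and along `ts` carries this to all descendants.
  below-↑ˡ : ∀ i ts → Below A′ (i ↑ˡ m′) ts ↔ Below A i ts
  below-↑ˡ i []             = ↔-trans (below-[] A′) (↔-sym (below-[] A))
  below-↑ˡ i (node us ∷ ts) = begin
    Below A′ (i ↑ˡ m′) (node us ∷ ts)
      ↔⟨ below-∷ A′ ⟩
    ((Σ[ j ∈ Fin (m + m′) ] A′ (i ↑ˡ m′) j ≡ 1F × Below A′ j us) × Below A′ (i ↑ˡ m′) ts)
      ↔⟨ Σ-row _ (A i) (A′-↑ˡ-↑ˡ i) (A′-↑ˡ-↑ʳ i) _ ×-↔ below-↑ˡ i ts ⟩
    ((Σ[ j ∈ Fin m ] A i j ≡ 1F × Below A′ (j ↑ˡ m′) us) × Below A i ts)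
      ↔⟨ Σ.congˡ {k = bijection} (λ {j} → ↔-refl ×-↔ below-↑ˡ j us) ×-↔ ↔-refl ⟩
    ((Σ[ j ∈ Fin m ] A i j ≡ 1F × Below A j us) × Below A i ts)
      ↔⟨ below-∷ A ⟨
    Below A i (node us ∷ ts) ∎

  -- The row is all ones on old colors and zero on new ones, so each child may have any old color,
  -- and `below-↑ˡ` handles what lies beneath it.
  below-↑ʳ : ∀ i ts → Below A′ (m ↑ʳ i) ts ↔ All (AColoring A) ts
  below-↑ʳ i []             = ↔-trans (below-[] A′) all-[]
  below-↑ʳ i (node us ∷ ts) = begin
    Below A′ (m ↑ʳ i) (node us ∷ ts)
      ↔⟨ below-∷ A′ ⟩
    ((Σ[ j ∈ Fin (m + m′) ] A′ (m ↑ʳ i) j ≡ 1F × Below A′ j us) × Below A′ (m ↑ʳ i) ts)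
      ↔⟨ Σ-row _ (λ _ → 1F) (A′-↑ʳ-↑ˡ i) (A′-↑ʳ-↑ʳ i) _ ×-↔ below-↑ʳ i ts ⟩
    ((Σ[ j ∈ Fin m ] 1F ≡ 1F × Below A′ (j ↑ˡ m′) us) × All (AColoring A) ts)
      ↔⟨ Σ.congˡ {k = bijection} (λ {j} → ↔-trans dropRefl (below-↑ˡ j us)) ×-↔ ↔-refl ⟩
    ((Σ[ j ∈ Fin m ] Below A j us) × All (AColoring A) ts)
      ↔⟨ coloring-node A ×-↔ ↔-refl ⟨
    (AColoring A (node us) × All (AColoring A) ts)
      ↔⟨ all-∷ ⟩
    All (AColoring A) (node us ∷ ts) ∎
    where
    dropRefl : ∀ {W : Set} → (_≡_ {A = Fin 2} 1F 1F × W) ↔ W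
    dropRefl = mk↔ₛ′ proj₂ (refl ,_) (λ _ → refl) (λ { (refl , w) → refl })

  tree-block : ∀ n → ColoredTree A′ (suc n) ↔ (ColoredTree A (suc n) ⊎ (Fin m′ × ColoredForest A n))
  tree-block n = begin
    ColoredTree A′ (suc n)
      ↔⟨ tree-suc A′ n ⟩
    (Σ[ f ∈ ForestOfSize n ] Σ[ i ∈ Fin (m + m′) ] Below A′ i (proj₁ f))
      ↔⟨ Σ.congˡ {k = bijection} (λ {f} → ↔-trans (Σ-Fin-+ m _)
           (Σ.congˡ {k = bijection} (λ {i} → below-↑ˡ i (proj₁ f)) ⊎-↔
            Σ.congˡ {k = bijection} (λ {i} → below-↑ʳ i (proj₁ f)))) ⟩
    (Σ[ f ∈ ForestOfSize n ]
      ((Σ[ i ∈ Fin m ] Below A i (proj₁ f)) ⊎ (Fin m′ × All (AColoring A) (proj₁ f))))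
      ↔⟨ Σ-distribˡ-⊎ ⟩
    ((Σ[ f ∈ ForestOfSize n ] Σ[ i ∈ Fin m ] Below A i (proj₁ f)) ⊎
     (Σ[ f ∈ ForestOfSize n ] Fin m′ × All (AColoring A) (proj₁ f)))
      -- The forest below a new root does not depend on which new color the root has, so that color
      -- moves out as a factor `Fin m′`.
      ↔⟨ ↔-sym (tree-suc A n) ⊎-↔ ∃∃↔∃∃ (λ f _ → All (AColoring A) (proj₁ f)) ⟩
    (ColoredTree A (suc n) ⊎ (Fin m′ × ColoredForest A n)) ∎

  F-block-suc : ∀ n → F A′ (suc n) ≡ F A (suc n) ℤ.+ + m′ ℤ.* forestSeries A n
  F-block-suc n = trans
    (cong +_ (↔⇒∣∣≡ (finite-ColoredTree A′ (suc n))
      (finite-⊎ (finite-ColoredTree A (suc n)) (finite-× (m′ , ↔-refl) (finite-ColoredForest A n)))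
      (tree-block n)))
    (cong (λ z → F A (suc n) ℤ.+ z) (ℤ.pos-* m′ _))

theorem25 : (m : ℕ) (A : ColoringMatrix m) (m′ : ℕ) → m′ ≥ 1 →
    let A′ : ColoringMatrix (m + m′)
        A′ = block A zeros ones zeros
    in F A′ ≈ F A ⊕ ((const (+ m′) ⊛ X) ÷ (const 1ℤ ⊖ F A) [ refl ])
theorem25 m A m′ _ n = trans (F-block n) (cong (λ z → F A n ℤ.+ z) (sym (quotient n)))
  where
  quotient : (const (+ m′) ⊛ X) ÷ (const 1ℤ ⊖ F A) [ refl ] ≈ shift (λ k → + m′ ℤ.* forestSeries A k)
  quotient = monomial-÷ (+ m′) (const 1ℤ ⊖ F A) refl (forestSeries A)
    (geometric (F A) refl (forestSeries A) (forestSeries-zero A) (forestSeries-suc A))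

  F-block : F (block A zeros ones zeros) ≈ F A ⊕ shift (λ k → + m′ ℤ.* forestSeries A k)
  -- There is no empty tree: both series `F` are 0 here by definition, and so is `shift`.
  F-block zero    = refl
  F-block (suc n) = F-block-suc A m′ n
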